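{- Let $p$ be a two-colored partition and let $r$ be one of the four basic rotations for which $p^r$ is defined. Then $Z(\{p^r\})=Z(\{p\})$, i.e. $F,V,\Sigma,L,K,X$ all take the same value on $\{p^r\}$ as on $\{p\}$.
   Context: A two-colored partition $p$ consists of a lower row $R_L$ and an upper row $R_U$ (disjoint, possibly empty, finite totally ordered sets), a decomposition of $P_p=R_L\cup R_U$ into disjoint nonempty blocks, and a coloring of each point by $\circ$ or $\bullet$. Orientation: the cyclic order on $P_p$ agreeing with the order of $R_L$ on $R_L$, with the reverse order of $R_U$ on $R_U$, with the maximum of $R_U$ succeeding the maximum of $R_L$ and the minimum of $R_L$ succeeding the minimum of $R_U$; intervals $]\alpha,\beta[_p$, $]\alpha,\beta]_p$ for distinct $\alpha,\beta$ refer to this cyclic order. Normalized color: color for lower points, inverse color for upper points. $\sigma_p(S)$: number of normalized-white minus number of normalized-black points of $S$; $\Sigma(p)=\sigma_p(P_p)$. Color distance: $\delta_p(\alpha,\alpha)=\Sigma(p)$; for $\alpha\ne\beta$, $\delta_p(\alpha,\beta)=\sigma_p(]\alpha,\beta[_p)$ if their normalized colors differ and $\sigma_p(]\alpha,\beta]_p)$ if they agree. Blocks $B\neq B'$ cross if there are $\alpha,\beta\in B$, $\alpha',\beta'\in B'$ that are pairwise distinct and appear in the cyclic order in the order $\alpha,\alpha',\beta,\beta'$. For a set $\mathcal S$ of partitions: $F(\mathcal S)=\{|B|: p\in\mathcal S, B$ block of $p\}$; $V(\mathcal S)=\{\sigma_p(B): p\in\mathcal S,B$ block of $p\}$; $\Sigma(\mathcal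 S)=\{\Sigma(p):p\in\mathcal S\}$; $L(\mathcal S)$ (resp. $K(\mathcal S)$) is the set of $\delta_p(\alpha_1,\alpha_2)$ over $p\in\mathcal S$, blocks $B$ of $p$, $\alpha_1\neq\alpha_2\in B$ with $]\alpha_1,\alpha_2[_p\cap B=\emptyset$ and $\sigma_p(\{\alpha_1,\alpha_2\})\neq0$ (resp. $=0$); $X(\mathcal S)$ is the set of $\delta_p(\alpha_1,\alpha_2)$ over $p\in\mathcal S$, crossing blocks $B_1,B_2$ of $p$, $\alpha_1\in B_1,\alpha_2\in B_2$. $Z=(F,V,\Sigma,L,K,X)$. The basic rotations: remove the leftmost (resp. rightmost) upper point $\alpha$ and add a new leftmost (resp. rightmost) lower point of inverse color replacing $\alpha$ in its block; or remove the leftmost (resp. rightmost) lower point and add a new leftmost (resp. rightmost) upper point of inverse color replacing it in its block. -}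

module Defs where

open import Data.Nat using (ℕ; zero; suc; _+_; _∸_; _<ᵇ_; _≡ᵇ_)
open import Data.Integer using (ℤ; 0ℤ; 1ℤ; -1ℤ) renaming (_+_ to _+ℤ_)
open import Data.Fin using (Fin; toℕ; fromℕ) renaming (_≟_ to _≟F_)
open import Data.Sum using (_⊎_; inj₁; inj₂)
open import Data.Sum.Properties using (≡-dec)
open import Data.List using (List; map; _++_; foldr)
open import Data.Nat.ListAction using (sum)
open import Data.List.Base using (allFin)
open import Data.Bool using (Bool; true; false; if_then_else_; _∧_; _∨_)
open import Data.Product using (Σ; _×_; _,_)
open import Data.Maybe using (Maybe; just; nothing)
open import Data.Vec.Functional using (Vector; _∷_; tail; init; head; last; insertAt)
open import Relation.Nullary using (¬_; does)
open import Relation.Binary.PropositionalEquality using (_≡_; _≢_)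

data Color : Set where
  white black : Color

inv : Color → Color
inv white = black
inv black = white

-- Lower row R_L = Fin k, upper row R_U = Fin l (ordered as Fin, so
-- "leftmost" = smallest index).  Blocks are the nonempty fibres of the
-- labelling maps blkL / blkU (points with the same label lie in the same
-- block); every block is nonempty by construction.

record TCP : Set where
  field
    k    : ℕ
    l    : ℕ
    blkL : Vector ℕ k
    blkU : Vector ℕ l
    colL : Vector Color k
    colU : Vector Color l
open TCP public

-- Points of P_p = R_L ∪ R_U : inj₁ = lower point, inj₂ = upper point.
Pt : TCP → Set
Pt p = Fin (k p) ⊎ Fin (l p)

blk : (p : TCP) → Pt p → ℕ
blk p (inj₁ i) = blkL p i
blk p (inj₂ j) = blkU p j

ncol : (p : TCP) → Pt p → Color
ncol p (inj₁ i) = colL p i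
ncol p (inj₂ j) = inv (colU p j)

sameColor : Color → Color → Bool
sameColor white white = true
sameColor black black = true
sameColor _ _ = false

allPts : (p : TCP) → List (Pt p)
allPts p = map inj₁ (allFin (k p)) ++ map inj₂ (allFin (l p))

wt : (p : TCP) → Pt p → ℤ
wt p α with ncol p α
... | white = 1ℤ
... | black = -1ℤ

σ : (p : TCP) → (Pt p → Bool) → ℤ
σ p S = foldr _+ℤ_ 0ℤ (map (λ γ → if S γ then wt p γ else 0ℤ) (allPts p))

Σp : TCP → ℤ
Σp p = σ p (λ _ → true)

-- Position in the cyclic order: lower points 0..k-1 in their order, then
-- upper points from the maximum of R_U (position k) down to the minimum of
-- R_U (position k+l-1), which is then followed by the minimum of R_L.
pos : (p : TCP) → Pt p → ℕ
pos p (inj₁ i) = toℕ i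
pos p (inj₂ j) = k p + (l p ∸ suc (toℕ j))

-- γ ∈ ]α,β[_p   (cyclic open interval, α ≠ β)
inOpen : (p : TCP) → Pt p → Pt p → Pt p → Bool
inOpen p α β γ =
  let a = pos p α ; b = pos p β ; c = pos p γ in
  if a <ᵇ b then (a <ᵇ c) ∧ (c <ᵇ b) else ((a <ᵇ c) ∨ (c <ᵇ b))

inHalf : (p : TCP) → Pt p → Pt p → Pt p → Bool
inHalf p α β γ = inOpen p α β γ ∨ (pos p γ ≡ᵇ pos p β)

_≟P_ : {p : TCP} → (α β : Pt p) → Relation.Nullary.Dec (α ≡ β)
_≟P_ = ≡-dec _≟F_ _≟F_

δ : (p : TCP) → Pt p → Pt p → ℤ
δ p α β =
  if does (_≟P_ {p} α β) then Σp p
  else (if sameColor (ncol p α) (ncol p β)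
        then σ p (inHalf p α β)
        else σ p (inOpen p α β))

inBlockOf : (p : TCP) → Pt p → Pt p → Bool
inBlockOf p α γ = blk p γ ≡ᵇ blk p α

blockSize : (p : TCP) → Pt p → ℕ
blockSize p α = sum (map (λ γ → if inBlockOf p α γ then 1 else 0) (allPts p))

Consecutive : (p : TCP) → Pt p → Pt p → Set
Consecutive p α₁ α₂ =
  (blk p α₁ ≡ blk p α₂) × (α₁ ≢ α₂) ×
  ((γ : Pt p) → inOpen p α₁ α₂ γ ≡ true → blk p γ ≢ blk p α₁)

Crossing : (p : TCP) → Pt p → Pt p → Set
Crossing p α₁ α₂ =
  (blk p α₁ ≢ blk p α₂) ×
  Σ (Pt p) λ α → Σ (Pt p) λ β → Σ (Pt p) λ α' → Σ (Pt p) λ β' →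
    (blk p α ≡ blk p α₁) × (blk p β ≡ blk p α₁) ×
    (blk p α' ≡ blk p α₂) × (blk p β' ≡ blk p α₂) ×
    (α ≢ β) × (α' ≢ β') ×
    (inOpen p α β α' ≡ true) × (inOpen p β α β' ≡ true)

-- The invariants F, V, Σ, L, K, X of the singleton {p}, as predicates
-- (membership in the respective sets).

F∈ : TCP → ℕ → Set
F∈ p n = Σ (Pt p) λ α → blockSize p α ≡ n

V∈ : TCP → ℤ → Set
V∈ p z = Σ (Pt p) λ α → σ p (inBlockOf p α) ≡ z

Σ∈ : TCP → ℤ → Set
Σ∈ p z = Σp p ≡ z

L∈ : TCP → ℤ → Set
L∈ p z = Σ (Pt p) λ α₁ → Σ (Pt p) λ α₂ →
  Consecutive p α₁ α₂ × (wt p α₁ +ℤ wt p α₂ ≢ 0ℤ) × (δ p α₁ α₂ ≡ z)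

K∈ : TCP → ℤ → Set
K∈ p z = Σ (Pt p) λ α₁ → Σ (Pt p) λ α₂ →
  Consecutive p α₁ α₂ × (wt p α₁ +ℤ wt p α₂ ≡ 0ℤ) × (δ p α₁ α₂ ≡ z)

X∈ : TCP → ℤ → Set
X∈ p z = Σ (Pt p) λ α₁ → Σ (Pt p) λ α₂ →
  Crossing p α₁ α₂ × (δ p α₁ α₂ ≡ z)

SameSet : {A : Set} → (A → Set) → (A → Set) → Set
SameSet P Q = ∀ x → (P x → Q x) × (Q x → P x)

SameZ : TCP → TCP → Set
SameZ p q =
  SameSet (F∈ p) (F∈ q) × SameSet (V∈ p) (V∈ q) × SameSet (Σ∈ p) (Σ∈ q) ×
  SameSet (L∈ p) (L∈ q) × SameSet (K∈ p) (K∈ q) × SameSet (X∈ p) (X∈ q)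

-- Basic rotations (nothing = rotation not defined)

data Rotation : Set where
  upperLeft  : Rotation
  upperRight : Rotation
  lowerLeft  : Rotation
  lowerRight : Rotation

snoc : {A : Set} {n : ℕ} → Vector A n → A → Vector A (suc n)
snoc {n = n} xs v = insertAt xs (fromℕ n) v

rotate : Rotation → TCP → Maybe TCP
rotate upperLeft  record { k = k ; l = zero } = nothing
rotate upperLeft  record { k = k ; l = suc l ; blkL = bL ; blkU = bU ; colL = cL ; colU = cU } =
  just record { k = suc k ; l = l ; blkL = head bU ∷ bL ; blkU = tail bU
              ; colL = inv (head cU) ∷ cL ; colU = tail cU }
rotate upperRight record { k = k ; l = zero } = nothing
rotate upperRight record { k = k ; l = suc l ; blkL = bL ; blkU = bU ; colL = cL ; colU = cU } =
  just record { k = suc k ; l = l ; blkL = snoc bL (last bU) ; blkU = init bU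
              ; colL = snoc cL (inv (last cU)) ; colU = init cU }
rotate lowerLeft  record { k = zero ; l = l } = nothing
rotate lowerLeft  record { k = suc k ; l = l ; blkL = bL ; blkU = bU ; colL = cL ; colU = cU } =
  just record { k = k ; l = suc l ; blkL = tail bL ; blkU = head bL ∷ bU
              ; colL = tail cL ; colU = inv (head cL) ∷ cU }
rotate lowerRight record { k = zero ; l = l } = nothing
rotate lowerRight record { k = suc k ; l = l ; blkL = bL ; blkU = bU ; colL = cL ; colU = cU } =
  just record { k = k ; l = suc l ; blkL = init bL ; blkU = snoc bU (last bL)
              ; colL = init cL ; colU = snoc cU (inv (last cL)) }

-- A basic rotation changes neither the cyclic order of the points, nor their
-- blocks, nor their normalised colours: it only relabels the points, which
-- shifts every cyclic position down by one (left rotations; the point at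
-- position 0 becomes the last one) or leaves all positions unchanged (right
-- rotations). Everything entering Z is defined from this data, so Z is
-- invariant under isomorphisms of partitions, and p^r is isomorphic to p.
module Submission where

open import Defs
open import Algebra.Bundles using (CommutativeMonoid)
open import Data.Bool using (Bool; true; false; _∧_; _∨_; if_then_else_)
open import Data.Bool.Properties using (∧-identityʳ; ∨-identityʳ)
open import Data.Empty using (⊥-elim)
open import Data.Fin using (Fin; zero; suc; toℕ; fromℕ; inject₁)
open import Data.Fin.Properties using (toℕ<n; toℕ-inject₁; toℕ-fromℕ)
open import Data.Fin.Relation.Unary.Top using (view; ‵fromℕ; ‵inject₁; view-fromℕ; view-inject₁)
open import Data.Integer using (ℤ; 0ℤ) renaming (_+_ to _+ℤ_)
import Data.Integer.Properties as ℤ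
open import Data.List using (_∷_; _∷ʳ_; map; foldr; _++_; tabulate; allFin)
open import Data.List.Properties using (map-cong; map-∘; map-id; map-++; map-tabulate; tabulate-cong; ++-assoc)
open import Data.List.Relation.Binary.Permutation.Propositional
  using (_↭_; ↭-sym; ↭-trans; ↭-reflexive; ↭⇒↭ₛ; module PermutationReasoning)
open import Data.List.Relation.Binary.Permutation.Propositional.Properties using (map⁺; shift; ++⁺ˡ; ∷↭∷ʳ)
open import Data.List.Relation.Binary.Permutation.Setoid.Properties using (foldr-commMonoid)
open import Data.Maybe using (just)
open import Data.Nat using (ℕ; zero; suc; _+_; _∸_; _≡ᵇ_; _<ᵇ_; _<_; _≤_; z≤n; s≤s; s≤s⁻¹)
open import Data.Nat.ListAction using (sum)
open import Data.Nat.ListAction.Properties using (sum-↭)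
open import Data.Nat.Properties using (≤-refl; <⇒≤; <-≤-trans; m≤m+n; +-monoʳ-<; ∸-monoʳ-<; n∸n≡0; +-identityʳ; +-∸-assoc; +-suc)
open import Data.Product using (_,_)
open import Data.Sum using (_⊎_; inj₁; inj₂)
open import Data.Vec.Functional using (Vector; tail)
open import Data.Vec.Functional.Properties using (insertAt-lookup)
open import Function using (_∘_; id)
open import Relation.Binary.Core using (_Preserves_⟶_)
open import Relation.Binary.PropositionalEquality
  using (_≡_; _≢_; refl; sym; trans; cong; cong₂; module ≡-Reasoning)
open import Relation.Nullary using (yes; no)

sumℤ-↭ : foldr _+ℤ_ 0ℤ Preserves _↭_ ⟶ _≡_
sumℤ-↭ xs↭ys = foldr-commMonoid ℤ+.setoid ℤ+.isCommutativeMonoid (↭⇒↭ₛ xs↭ys)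
  where module ℤ+ = CommutativeMonoid ℤ.+-0-commutativeMonoid

σ-cong : ∀ (p : TCP) {S T : Pt p → Bool} → (∀ γ → S γ ≡ T γ) → σ p S ≡ σ p T
σ-cong p S≗T = cong (foldr _+ℤ_ 0ℤ)
  (map-cong (λ γ → cong (λ b → if b then wt p γ else 0ℤ) (S≗T γ)) (allPts p))

record _≅_ (q p : TCP) : Set where
  field
    to         : Pt q → Pt p
    from       : Pt p → Pt q
    from-to    : ∀ x → from (to x) ≡ x
    to-from    : ∀ y → to (from y) ≡ y
    blk-to     : ∀ x → blk p (to x) ≡ blk q x
    ncol-to    : ∀ x → ncol p (to x) ≡ ncol q x
    inOpen-to  : ∀ a b c → inOpen p (to a) (to b) (to c) ≡ inOpen q a b c
    samePos-to : ∀ a b → (pos p (to a) ≡ᵇ pos p (to b)) ≡ (pos q a ≡ᵇ pos q b)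
    allPts-to  : map to (allPts q) ↭ allPts p

≅-sym : ∀ {q p} → q ≅ p → p ≅ q
≅-sym {q} {p} I = record
  { to         = from
  ; from       = to
  ; from-to    = to-from
  ; to-from    = from-to
  ; blk-to     = λ y → trans (sym (blk-to (from y))) (cong (blk p) (to-from y))
  ; ncol-to    = λ y → trans (sym (ncol-to (from y))) (cong (ncol p) (to-from y))
  ; inOpen-to  = inOpen-from
  ; samePos-to = samePos-from
  ; allPts-to  = ↭-trans (map⁺ from (↭-sym allPts-to)) (↭-reflexive from∘to-allPts)
  }
  where
  open _≅_ I

  inOpen-from : ∀ a b c → inOpen q (from a) (from b) (from c) ≡ inOpen p a b c
  inOpen-from a b c
    rewrite sym (inOpen-to (from a) (from b) (from c)) | to-from a | to-from b | to-from c = refl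

  samePos-from : ∀ a b → (pos q (from a) ≡ᵇ pos q (from b)) ≡ (pos p a ≡ᵇ pos p b)
  samePos-from a b rewrite sym (samePos-to (from a) (from b)) | to-from a | to-from b = refl

  from∘to-allPts : map from (map to (allPts q)) ≡ allPts q
  from∘to-allPts = begin
    map from (map to (allPts q))  ≡⟨ map-∘ (allPts q) ⟨
    map (from ∘ to) (allPts q)    ≡⟨ map-cong from-to (allPts q) ⟩
    map id (allPts q)             ≡⟨ map-id (allPts q) ⟩
    allPts q                      ∎
    where open ≡-Reasoning

module Transfer {q p : TCP} (I : q ≅ p) where
  open _≅_ I

  to-injective : ∀ {a b} → to a ≡ to b → a ≡ b
  to-injective {a} {b} e = trans (sym (from-to a)) (trans (cong from e) (from-to b))

  blk-to-cong : ∀ {a b} → blk q a ≡ blk q b → blk p (to a) ≡ blk p (to b)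
  blk-to-cong {a} {b} e = trans (blk-to a) (trans e (sym (blk-to b)))

  wt-to : ∀ x → wt p (to x) ≡ wt q x
  wt-to x with ncol p (to x) | ncol q x | ncol-to x
  ... | white | white | refl = refl
  ... | black | black | refl = refl

  map-to-↭ : ∀ {A : Set} (g : Pt p → A) → map (g ∘ to) (allPts q) ↭ map g (allPts p)
  map-to-↭ g = ↭-trans (↭-reflexive (map-∘ (allPts q))) (map⁺ g allPts-to)

  σ-to : ∀ S → σ p S ≡ σ q (S ∘ to)
  σ-to S = trans (sym (sumℤ-↭ (map-to-↭ term)))
    (cong (foldr _+ℤ_ 0ℤ) (map-cong (λ x → cong (λ w → if S (to x) then w else 0ℤ) (wt-to x)) (allPts q)))
    where
    term : Pt p → ℤ
    term γ = if S γ then wt p γ else 0ℤ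

  inHalf-to : ∀ a b c → inHalf p (to a) (to b) (to c) ≡ inHalf q a b c
  inHalf-to a b c = cong₂ _∨_ (inOpen-to a b c) (samePos-to c b)

  δ-to : ∀ a b → δ p (to a) (to b) ≡ δ q a b
  δ-to a b with _≟P_ {q} a b | _≟P_ {p} (to a) (to b)
  ... | yes _    | yes _   = σ-to (λ _ → true)
  ... | yes refl | no a≢a  = ⊥-elim (a≢a refl)
  ... | no a≢b   | yes e   = ⊥-elim (a≢b (to-injective e))
  ... | no _     | no _    rewrite ncol-to a | ncol-to b with sameColor (ncol q a) (ncol q b)
  ...   | true  = trans (σ-to _) (σ-cong q (inHalf-to a b))
  ...   | false = trans (σ-to _) (σ-cong q (inOpen-to a b))

  blockSize-to : ∀ a → blockSize p (to a) ≡ blockSize q a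
  blockSize-to a = trans (sym (sum-↭ (map-to-↭ indicator)))
    (cong sum (map-cong (λ x → cong (λ v → if v then 1 else 0) (cong₂ _≡ᵇ_ (blk-to x) (blk-to a))) (allPts q)))
    where
    indicator : Pt p → ℕ
    indicator γ = if inBlockOf p (to a) γ then 1 else 0

  inOpen-from-true : ∀ {a b} γ → inOpen p (to a) (to b) γ ≡ true → inOpen q a b (from γ) ≡ true
  inOpen-from-true {a} {b} γ h =
    trans (sym (inOpen-to a b (from γ))) (trans (cong (inOpen p (to a) (to b)) (to-from γ)) h)

  Consecutive-to : ∀ {a b} → Consecutive q a b → Consecutive p (to a) (to b)
  Consecutive-to {a} {b} (same , a≢b , gap) = blk-to-cong same , a≢b ∘ to-injective , gap′
    where
    gap′ : ∀ γ → inOpen p (to a) (to b) γ ≡ true → blk p γ ≢ blk p (to a)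
    gap′ γ γ∈ γ∈B = gap (from γ) (inOpen-from-true γ γ∈)
      (trans (sym (blk-to (from γ))) (trans (cong (blk p) (to-from γ)) (trans γ∈B (blk-to a))))

  Crossing-to : ∀ {a b} → Crossing q a b → Crossing p (to a) (to b)
  Crossing-to {a} {b} (a≁b , α , β , α′ , β′ , e₁ , e₂ , e₃ , e₄ , α≢β , α′≢β′ , o₁ , o₂) =
    (λ h → a≁b (trans (sym (blk-to a)) (trans h (blk-to b)))) ,
    to α , to β , to α′ , to β′ ,
    blk-to-cong e₁ , blk-to-cong e₂ , blk-to-cong e₃ , blk-to-cong e₄ ,
    α≢β ∘ to-injective , α′≢β′ ∘ to-injective ,
    trans (inOpen-to α β α′) o₁ , trans (inOpen-to β α β′) o₂

  F∈-to : ∀ {n} → F∈ q n → F∈ p n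
  F∈-to (α , e) = to α , trans (blockSize-to α) e

  V∈-to : ∀ {z} → V∈ q z → V∈ p z
  V∈-to (α , e) = to α , trans (σ-to _) (trans (σ-cong q λ x → cong₂ _≡ᵇ_ (blk-to x) (blk-to α)) e)

  Σ∈-to : ∀ {z} → Σ∈ q z → Σ∈ p z
  Σ∈-to e = trans (σ-to _) e

  L∈-to : ∀ {z} → L∈ q z → L∈ p z
  L∈-to (a , b , c , w , d) =
    to a , to b , Consecutive-to c , w ∘ trans (sym (cong₂ _+ℤ_ (wt-to a) (wt-to b))) , trans (δ-to a b) d

  K∈-to : ∀ {z} → K∈ q z → K∈ p z
  K∈-to (a , b , c , w , d) =
    to a , to b , Consecutive-to c , trans (cong₂ _+ℤ_ (wt-to a) (wt-to b)) w , trans (δ-to a b) d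

  X∈-to : ∀ {z} → X∈ q z → X∈ p z
  X∈-to (a , b , c , d) = to a , to b , Crossing-to c , trans (δ-to a b) d

≅⇒SameZ : ∀ {q p} → q ≅ p → SameZ q p
≅⇒SameZ {q} {p} I =
  (λ _ → F∈-to I , F∈-to J) , (λ _ → V∈-to I , V∈-to J) , (λ _ → Σ∈-to I , Σ∈-to J) ,
  (λ _ → L∈-to I , L∈-to J) , (λ _ → K∈-to I , K∈-to J) , (λ _ → X∈-to I , X∈-to J)
  where
  open Transfer

  J : p ≅ q
  J = ≅-sym I

cong₃ : ∀ {A B C D : Set} (f : A → B → C → D) {a a′ b b′ c c′} →
        a ≡ a′ → b ≡ b′ → c ≡ c′ → f a b c ≡ f a′ b′ c′
cong₃ f refl refl refl = refl

<ᵇ-true : ∀ {m n} → m < n → (m <ᵇ n) ≡ true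
<ᵇ-true {zero}  {suc n} _         = refl
<ᵇ-true {suc m} {suc n} (s≤s m<n) = <ᵇ-true m<n

<ᵇ-false : ∀ {m n} → n ≤ m → (m <ᵇ n) ≡ false
<ᵇ-false {n = zero}          z≤n       = refl
<ᵇ-false {suc m} {suc n} (s≤s n≤m) = <ᵇ-false n≤m

≡ᵇ-false : ∀ {m n} → m < n → (m ≡ᵇ n) ≡ false
≡ᵇ-false {zero}  {suc n} _         = refl
≡ᵇ-false {suc m} {suc n} (s≤s m<n) = ≡ᵇ-false m<n

≡ᵇ-sym : ∀ m n → (m ≡ᵇ n) ≡ (n ≡ᵇ m)
≡ᵇ-sym zero    zero    = refl
≡ᵇ-sym zero    (suc n) = refl
≡ᵇ-sym (suc m) zero    = refl
≡ᵇ-sym (suc m) (suc n) = ≡ᵇ-sym m n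

≡ᵇ-refl : ∀ n → (n ≡ᵇ n) ≡ true
≡ᵇ-refl zero    = refl
≡ᵇ-refl (suc n) = ≡ᵇ-refl n

-- `inOpen p α β γ` unfolds to `cyclicBetween (pos p α) (pos p β) (pos p γ)`.
cyclicBetween : ℕ → ℕ → ℕ → Bool
cyclicBetween a b c = if a <ᵇ b then (a <ᵇ c) ∧ (c <ᵇ b) else ((a <ᵇ c) ∨ (c <ᵇ b))

cyclicPred : ℕ → ℕ → ℕ
cyclicPred n zero    = n
cyclicPred n (suc m) = m

cyclicBetween-cyclicPred : ∀ {n} a b c → a ≤ n → b ≤ n → c ≤ n →
  cyclicBetween (cyclicPred n a) (cyclicPred n b) (cyclicPred n c) ≡ cyclicBetween a b c
cyclicBetween-cyclicPred {n} zero zero zero _ _ _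
  rewrite <ᵇ-false (≤-refl {n}) = refl
cyclicBetween-cyclicPred {n} zero zero (suc c) _ _ c<n
  rewrite <ᵇ-false (≤-refl {n}) | <ᵇ-false (<⇒≤ c<n) | <ᵇ-true c<n = refl
cyclicBetween-cyclicPred {n} zero (suc b) zero _ b<n _
  rewrite <ᵇ-false (<⇒≤ b<n) | <ᵇ-false (≤-refl {n}) = refl
cyclicBetween-cyclicPred {n} zero (suc b) (suc c) _ b<n c<n
  rewrite <ᵇ-false (<⇒≤ b<n) | <ᵇ-false (<⇒≤ c<n) = refl
cyclicBetween-cyclicPred {n} (suc a) zero zero a<n _ _
  rewrite <ᵇ-true a<n | <ᵇ-false (≤-refl {n}) = refl
cyclicBetween-cyclicPred {n} (suc a) zero (suc c) a<n _ c<n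
  rewrite <ᵇ-true a<n | <ᵇ-true c<n = trans (∧-identityʳ _) (sym (∨-identityʳ _))
cyclicBetween-cyclicPred {n} (suc a) (suc b) zero a<n b<n _
  rewrite <ᵇ-true a<n | <ᵇ-false (<⇒≤ b<n) = refl
cyclicBetween-cyclicPred (suc a) (suc b) (suc c) _ _ _ = refl

≡ᵇ-cyclicPred : ∀ {n} a b → a ≤ n → b ≤ n → (cyclicPred n a ≡ᵇ cyclicPred n b) ≡ (a ≡ᵇ b)
≡ᵇ-cyclicPred {n} zero    zero    _   _   = ≡ᵇ-refl n
≡ᵇ-cyclicPred {n} zero    (suc b) _   b<n = trans (≡ᵇ-sym n b) (≡ᵇ-false b<n)
≡ᵇ-cyclicPred {n} (suc a) zero    a<n _   = ≡ᵇ-false a<n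
≡ᵇ-cyclicPred     (suc a) (suc b) _   _   = refl

pos<k+l : ∀ p (x : Pt p) → pos p x < k p + l p
pos<k+l p (inj₁ i) = <-≤-trans (toℕ<n i) (m≤m+n (k p) (l p))
pos<k+l p (inj₂ j) = +-monoʳ-< (k p) (∸-monoʳ-< (s≤s z≤n) (toℕ<n j))

map-allPts : ∀ {A : Set} p (f : Pt p → A) →
  map f (allPts p) ≡ tabulate (f ∘ inj₁) ++ tabulate (f ∘ inj₂)
map-allPts p f = trans (map-++ f (map inj₁ (allFin (k p))) _)
  (cong₂ _++_ (map-map-allFin inj₁) (map-map-allFin inj₂))
  where
  map-map-allFin : ∀ {n} (g : Fin n → Pt p) → map f (map g (allFin n)) ≡ tabulate (f ∘ g)
  map-map-allFin {n} g = trans (sym (map-∘ (allFin n))) (map-tabulate id (f ∘ g))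

tabulate-∷ʳ : ∀ {A : Set} {n} (f : Fin (suc n) → A) →
  tabulate f ≡ tabulate (f ∘ inject₁) ∷ʳ f (fromℕ n)
tabulate-∷ʳ {n = zero}  f = refl
tabulate-∷ʳ {n = suc n} f = cong (f zero ∷_) (tabulate-∷ʳ (f ∘ suc))

partition : (k l : ℕ) → Vector ℕ k → Vector ℕ l → Vector Color k → Vector Color l → TCP
partition k l bL bU cL cU = record { k = k ; l = l ; blkL = bL ; blkU = bU ; colL = cL ; colU = cU }

moveLeft : ∀ {K L} → Fin (suc K) ⊎ Fin L → Fin K ⊎ Fin (suc L)
moveLeft (inj₁ zero)    = inj₂ zero
moveLeft (inj₁ (suc i)) = inj₁ i
moveLeft (inj₂ j)       = inj₂ (suc j)

moveLeft⁻¹ : ∀ {K L} → Fin K ⊎ Fin (suc L) → Fin (suc K) ⊎ Fin L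
moveLeft⁻¹ (inj₁ i)       = inj₁ (suc i)
moveLeft⁻¹ (inj₂ zero)    = inj₁ zero
moveLeft⁻¹ (inj₂ (suc j)) = inj₂ j

moveRight : ∀ {K L} → Fin (suc K) ⊎ Fin L → Fin K ⊎ Fin (suc L)
moveRight {L = L} (inj₁ i) with view i
... | ‵fromℕ      = inj₂ (fromℕ L)
... | ‵inject₁ i′ = inj₁ i′
moveRight (inj₂ j) = inj₂ (inject₁ j)

moveRight⁻¹ : ∀ {K L} → Fin K ⊎ Fin (suc L) → Fin (suc K) ⊎ Fin L
moveRight⁻¹ (inj₁ i) = inj₁ (inject₁ i)
moveRight⁻¹ {K} (inj₂ j) with view j
... | ‵fromℕ      = inj₁ (fromℕ K)
... | ‵inject₁ j′ = inj₂ j′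

module _ {K L : ℕ}
         {bL : Vector ℕ (suc K)} {bU : Vector ℕ L} {cL : Vector Color (suc K)} {cU : Vector Color L}
         {bL′ : Vector ℕ K} {bU′ : Vector ℕ (suc L)} {cL′ : Vector Color K} {cU′ : Vector Color (suc L)}
         where
  private
    q p : TCP
    q = partition (suc K) L bL bU cL cU
    p = partition K (suc L) bL′ bU′ cL′ cU′

    pos≤ : ∀ x → pos q x ≤ K + L
    pos≤ x = s≤s⁻¹ (pos<k+l q x)

  moveLeft-≅ : (∀ x → blk p (moveLeft x) ≡ blk q x) → (∀ x → ncol p (moveLeft x) ≡ ncol q x) → q ≅ p
  moveLeft-≅ blk-to ncol-to = record
    { to         = moveLeft
    ; from       = moveLeft⁻¹
    ; from-to    = λ { (inj₁ zero) → refl ; (inj₁ (suc _)) → refl ; (inj₂ _) → refl }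
    ; to-from    = λ { (inj₁ _) → refl ; (inj₂ zero) → refl ; (inj₂ (suc _)) → refl }
    ; blk-to     = blk-to
    ; ncol-to    = ncol-to
    ; inOpen-to  = λ a b c → trans (cong₃ cyclicBetween (pos-to a) (pos-to b) (pos-to c))
                                   (cyclicBetween-cyclicPred _ _ _ (pos≤ a) (pos≤ b) (pos≤ c))
    ; samePos-to = λ a b → trans (cong₂ _≡ᵇ_ (pos-to a) (pos-to b)) (≡ᵇ-cyclicPred _ _ (pos≤ a) (pos≤ b))
    ; allPts-to  = allPts-to
    }
    where
    pos-to : ∀ x → pos p (moveLeft x) ≡ cyclicPred (K + L) (pos q x)
    pos-to (inj₁ zero)    = refl
    pos-to (inj₁ (suc i)) = refl
    pos-to (inj₂ j)       = refl

    allPts-to : map moveLeft (allPts q) ↭ allPts p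
    allPts-to = begin
      map moveLeft (allPts q)                             ≡⟨ map-allPts q moveLeft ⟩
      inj₂ zero ∷ tabulate inj₁ ++ tabulate (inj₂ ∘ suc)  ↭⟨ shift (inj₂ zero) (tabulate inj₁) _ ⟨
      tabulate inj₁ ++ tabulate inj₂                      ≡⟨ map-allPts p id ⟨
      map id (allPts p)                                   ≡⟨ map-id (allPts p) ⟩
      allPts p                                            ∎
      where open PermutationReasoning

  moveRight-≅ : (∀ x → blk p (moveRight x) ≡ blk q x) → (∀ x → ncol p (moveRight x) ≡ ncol q x) → q ≅ p
  moveRight-≅ blk-to ncol-to = record
    { to         = moveRight
    ; from       = moveRight⁻¹
    ; from-to    = from-to
    ; to-from    = to-from
    ; blk-to     = blk-to
    ; ncol-to    = ncol-to
    ; inOpen-to  = λ a b c → cong₃ cyclicBetween (pos-to a) (pos-to b) (pos-to c)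
    ; samePos-to = λ a b → cong₂ _≡ᵇ_ (pos-to a) (pos-to b)
    ; allPts-to  = allPts-to
    }
    where
    moveRight-inject₁ : ∀ i → moveRight {K} {L} (inj₁ (inject₁ i)) ≡ inj₁ i
    moveRight-inject₁ i rewrite view-inject₁ i = refl

    moveRight-fromℕ : moveRight {K} {L} (inj₁ (fromℕ K)) ≡ inj₂ (fromℕ L)
    moveRight-fromℕ rewrite view-fromℕ K = refl

    from-to : ∀ (x : Pt q) → moveRight⁻¹ (moveRight x) ≡ x
    from-to (inj₁ i) with view i
    ... | ‵fromℕ rewrite view-fromℕ L = refl
    ... | ‵inject₁ _ = refl
    from-to (inj₂ j) rewrite view-inject₁ j = refl

    to-from : ∀ (y : Pt p) → moveRight (moveRight⁻¹ y) ≡ y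
    to-from (inj₁ i) = moveRight-inject₁ i
    to-from (inj₂ j) with view j
    ... | ‵fromℕ = moveRight-fromℕ
    ... | ‵inject₁ _ = refl

    pos-to : ∀ x → pos p (moveRight x) ≡ pos q x
    pos-to (inj₁ i) with view i
    ... | ‵inject₁ i′ = sym (toℕ-inject₁ i′)
    ... | ‵fromℕ = begin
      K + (L ∸ toℕ (fromℕ L))  ≡⟨ cong (λ t → K + (L ∸ t)) (toℕ-fromℕ L) ⟩
      K + (L ∸ L)              ≡⟨ cong (K +_) (n∸n≡0 L) ⟩
      K + 0                    ≡⟨ +-identityʳ K ⟩
      K                        ≡⟨ toℕ-fromℕ K ⟨
      toℕ (fromℕ K)            ∎
      where open ≡-Reasoning
    pos-to (inj₂ j) = begin
      K + (L ∸ toℕ (inject₁ j))    ≡⟨ cong (λ t → K + (L ∸ t)) (toℕ-inject₁ j) ⟩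
      K + (L ∸ toℕ j)              ≡⟨ cong (K +_) (+-∸-assoc 1 (toℕ<n j)) ⟩
      K + suc (L ∸ suc (toℕ j))    ≡⟨ +-suc K _ ⟩
      suc (K + (L ∸ suc (toℕ j)))  ∎
      where open ≡-Reasoning

    allPts-to : map moveRight (allPts q) ↭ allPts p
    allPts-to = begin
      map moveRight (allPts q)
        ≡⟨ map-allPts q moveRight ⟩
      tabulate (moveRight ∘ inj₁) ++ tabulate (inj₂ ∘ inject₁)
        ≡⟨ cong (_++ tabulate (inj₂ ∘ inject₁)) (tabulate-∷ʳ (moveRight ∘ inj₁)) ⟩
      (tabulate (moveRight ∘ inj₁ ∘ inject₁) ∷ʳ moveRight (inj₁ (fromℕ K))) ++ tabulate (inj₂ ∘ inject₁)
        ≡⟨ cong₂ (λ xs y → (xs ∷ʳ y) ++ tabulate (inj₂ ∘ inject₁)) (tabulate-cong moveRight-inject₁) moveRight-fromℕ ⟩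
      (tabulate inj₁ ∷ʳ inj₂ (fromℕ L)) ++ tabulate (inj₂ ∘ inject₁)
        ≡⟨ ++-assoc (tabulate inj₁) _ _ ⟩
      tabulate inj₁ ++ (inj₂ (fromℕ L) ∷ tabulate (inj₂ ∘ inject₁))
        ↭⟨ ++⁺ˡ (tabulate inj₁) (∷↭∷ʳ _ _) ⟩
      tabulate inj₁ ++ (tabulate (inj₂ ∘ inject₁) ∷ʳ inj₂ (fromℕ L))
        ≡⟨ cong (tabulate inj₁ ++_) (tabulate-∷ʳ inj₂) ⟨
      tabulate inj₁ ++ tabulate inj₂
        ≡⟨ map-allPts p id ⟨
      map id (allPts p)
        ≡⟨ map-id (allPts p) ⟩
      allPts p
        ∎
      where open PermutationReasoning

inv-involutive : ∀ c → inv (inv c) ≡ c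
inv-involutive white = refl
inv-involutive black = refl

snoc-inject₁ : ∀ {A : Set} {n} (xs : Vector A n) (v : A) (i : Fin n) → snoc xs v (inject₁ i) ≡ xs i
snoc-inject₁ xs v zero    = refl
snoc-inject₁ xs v (suc i) = snoc-inject₁ (tail xs) v i

snoc-fromℕ : ∀ {A : Set} {n} (xs : Vector A n) (v : A) → snoc xs v (fromℕ n) ≡ v
snoc-fromℕ {n = n} xs v = insertAt-lookup xs (fromℕ n) v

rotate-≅ : ∀ r p {q} → rotate r p ≡ just q → q ≅ p
rotate-≅ upperLeft record { l = suc _ } refl = moveLeft-≅
  (λ { (inj₁ zero) → refl ; (inj₁ (suc _)) → refl ; (inj₂ _) → refl })
  (λ { (inj₁ zero) → refl ; (inj₁ (suc _)) → refl ; (inj₂ _) → refl })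
rotate-≅ lowerLeft record { k = suc _ ; colL = cL } refl = ≅-sym (moveLeft-≅
  (λ { (inj₁ zero) → refl ; (inj₁ (suc _)) → refl ; (inj₂ _) → refl })
  (λ { (inj₁ zero) → inv-involutive (cL zero) ; (inj₁ (suc _)) → refl ; (inj₂ _) → refl }))
rotate-≅ upperRight p@record { l = suc l ; blkL = bL ; blkU = bU ; colL = cL ; colU = cU } {q} refl =
  moveRight-≅ blk-to ncol-to
  where
  blk-to : ∀ x → blk p (moveRight x) ≡ blk q x
  blk-to (inj₁ i) with view i
  ... | ‵fromℕ      = sym (snoc-fromℕ bL (bU (fromℕ l)))
  ... | ‵inject₁ i′ = sym (snoc-inject₁ bL (bU (fromℕ l)) i′)
  blk-to (inj₂ j) = refl

  ncol-to : ∀ x → ncol p (moveRight x) ≡ ncol q x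
  ncol-to (inj₁ i) with view i
  ... | ‵fromℕ      = sym (snoc-fromℕ cL (inv (cU (fromℕ l))))
  ... | ‵inject₁ i′ = sym (snoc-inject₁ cL (inv (cU (fromℕ l))) i′)
  ncol-to (inj₂ j) = refl
rotate-≅ lowerRight p@record { k = suc k ; blkL = bL ; blkU = bU ; colL = cL ; colU = cU } {q} refl =
  ≅-sym (moveRight-≅ blk-to ncol-to)
  where
  blk-to : ∀ x → blk q (moveRight x) ≡ blk p x
  blk-to (inj₁ i) with view i
  ... | ‵fromℕ      = snoc-fromℕ bU (bL (fromℕ k))
  ... | ‵inject₁ _  = refl
  blk-to (inj₂ j) = snoc-inject₁ bU (bL (fromℕ k)) j

  ncol-to : ∀ x → ncol q (moveRight x) ≡ ncol p x
  ncol-to (inj₁ i) with view i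
  ... | ‵fromℕ      = trans (cong inv (snoc-fromℕ cU (inv (cL (fromℕ k))))) (inv-involutive (cL (fromℕ k)))
  ... | ‵inject₁ _  = refl
  ncol-to (inj₂ j) = cong inv (snoc-inject₁ cU (inv (cL (fromℕ k))) j)
rotate-≅ upperLeft  record { l = zero } ()
rotate-≅ upperRight record { l = zero } ()
rotate-≅ lowerLeft  record { k = zero } ()
rotate-≅ lowerRight record { k = zero } ()

lemma6p3 : (p : TCP) (r : Rotation) (q : TCP) → rotate r p ≡ just q → SameZ q p
lemma6p3 p r _ rotated = ≅⇒SameZ (rotate-≅ r p rotated)
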